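{- For every integer $n\geq 5$, the full automorphism group of the pancake graph $P_n$ is $\mathrm{Aut}(P_n)=L(S_n)$, where $L(S_n)$ is the left regular representation of $S_n$.
   Context: For $n\ge 2$ and $2\leq j\leq n$, let $r_{1j}\in S_n$ be the prefix reversal, i.e. the permutation of $\{1,\dots,n\}$ with $r_{1j}(k)=j+1-k$ for $1\leq k\leq j$ and $r_{1j}(k)=k$ for $j<k\leq n$. Let $PR_n=\{r_{1j}: 2\leq j\leq n\}$. The pancake graph $P_n$ is the Cayley graph $\mathrm{Cay}(S_n,PR_n)$: the simple undirected graph with vertex set the symmetric group $S_n$ and edges $\{g,gs\}$ for $g\in S_n$, $s\in PR_n$, where products of permutations are composed as $(gs)(k)=g(s(k))$. $\mathrm{Aut}(P_n)$ denotes the group of all graph automorphisms of $P_n$, viewed as permutations of the vertex set $S_n$. $L(S_n)=\{L(y): y\in S_n\}$, where $L(y):S_n\to S_n$ is left multiplication $x\mapsto yx$. -}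

module Defs where

open import Level using (Level; 0ℓ; _⊔_; suc)
open import Algebra.Bundles using (Group)
import Algebra.Properties.Group as GroupProperties
open import Data.Nat.Base using (ℕ; _∸_; _≤_; _<_; z≤n; s≤s)
import Data.Nat.Base as ℕ
open import Data.Nat.Properties
  using (_<?_; <-≤-trans; m∸n≤m; m∸[m∸n]≡n)
open import Data.Fin.Base using (Fin; toℕ; fromℕ<)
open import Data.Fin.Properties using (toℕ-injective; toℕ-fromℕ<)
open import Data.Fin.Permutation as Perm
  using (Permutation′; permutation; _⟨$⟩ʳ_; _⟨$⟩ˡ_; _∘ₚ_; flip; inverseˡ; inverseʳ)
open import Data.Product.Base using (Σ-syntax; ∃-syntax; _×_; _,_)
open import Data.Sum.Base using (_⊎_; inj₁; inj₂; swap)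
open import Function.Bundles using (Inverse; _⇔_)
open import Relation.Binary.Bundles using (Setoid)
open import Relation.Binary.Core using (Rel)
open import Relation.Binary.Definitions using (Symmetric)
open import Relation.Binary.PropositionalEquality.Core
  using (_≡_; refl; sym; trans; cong; subst)
open import Relation.Nullary.Decidable.Core using (Dec; yes; no)
open import Relation.Nullary.Negation.Core using (¬_; contradiction)
open import Relation.Unary using (Pred)

record SimpleGraph (c ℓ e : Level) : Set (suc (c ⊔ ℓ ⊔ e)) where
  field
    vertices : Setoid c ℓ

  open Setoid vertices public using () renaming (Carrier to Vertex; _≈_ to _≈ᵥ_)

  field
    Adj         : Rel Vertex e
    Adj-resp-≈ᵥ : ∀ {x x′ y y′} → x ≈ᵥ x′ → y ≈ᵥ y′ → Adj x y → Adj x′ y′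
    Adj-sym     : Symmetric Adj
    Adj-irrefl  : ∀ {x} → ¬ Adj x x

-- Permutations of the set presented by a setoid, compared pointwise.
module _ {c ℓ : Level} (X : Setoid c ℓ) where
  open Setoid X using (Carrier; _≈_)

  SelfBijection : Set (c ⊔ ℓ)
  SelfBijection = Inverse X X

  _≋_ : Rel SelfBijection (c ⊔ ℓ)
  φ ≋ ψ = ∀ (x : Carrier) → Inverse.to φ x ≈ Inverse.to ψ x

module _ {c ℓ e : Level} (Γ : SimpleGraph c ℓ e) where
  open SimpleGraph Γ

  -- The automorphism group, as a subset of the permutations of the vertices.
  Aut : Pred (SelfBijection vertices) (c ⊔ e)
  Aut φ = ∀ (x y : Vertex) → Adj x y ⇔ Adj (Inverse.to φ x) (Inverse.to φ y)

module _ {c ℓ : Level} (G : Group c ℓ) where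
  open Group G renaming (refl to ≈-refl; sym to ≈-sym; trans to ≈-trans)
  open GroupProperties G using (\\-leftDividesˡ; \\-leftDividesʳ; identityʳ-unique)

  L : Carrier → SelfBijection setoid
  L y = record
    { to        = y ∙_
    ; from      = y ⁻¹ ∙_
    ; to-cong   = ∙-congˡ
    ; from-cong = ∙-congˡ
    ; inverse   = (λ eq → ≈-trans (∙-congˡ eq) (\\-leftDividesˡ y _))
                , (λ eq → ≈-trans (∙-congˡ eq) (\\-leftDividesʳ y _))
    }

  LeftRegular : Pred (SelfBijection setoid) (c ⊔ ℓ)
  LeftRegular φ = ∃[ y ] _≋_ setoid φ (L y)

  -- The unordered pair {g , h} is of the form {k , k ∙ s} with s in S iff
  -- h ≈ g ∙ s or g ≈ h ∙ s for such an s.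
  Cay : {p : Level} (S : Pred Carrier p) → (∀ s → S s → ¬ (s ≈ ε)) →
        SimpleGraph c ℓ (c ⊔ ℓ ⊔ p)
  Cay S ε∉S = record
    { vertices    = setoid
    ; Adj         = λ g h → ∃[ s ] (S s × (h ≈ g ∙ s ⊎ g ≈ h ∙ s))
    ; Adj-resp-≈ᵥ = λ where
        x≈ y≈ (s , s∈S , inj₁ eq) →
          s , s∈S , inj₁ (≈-trans (≈-sym y≈) (≈-trans eq (∙-congʳ x≈)))
        x≈ y≈ (s , s∈S , inj₂ eq) →
          s , s∈S , inj₂ (≈-trans (≈-sym x≈) (≈-trans eq (∙-congʳ y≈)))
    ; Adj-sym     = λ (s , s∈S , eq) → s , s∈S , swap eq
    ; Adj-irrefl  = λ where
        (s , s∈S , inj₁ eq) → ε∉S s s∈S (identityʳ-unique _ s (≈-sym eq))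
        (s , s∈S , inj₂ eq) → ε∉S s s∈S (identityʳ-unique _ s (≈-sym eq))
    }

-- The product g ∙ s applies s first; the library's _∘ₚ_ composes in
-- diagrammatic order, hence the swapped arguments.
Sym : ℕ → Group 0ℓ 0ℓ
Sym n = record
  { Carrier = Permutation′ n
  ; _≈_     = Perm._≈_
  ; _∙_     = λ g s → s ∘ₚ g
  ; ε       = Perm.id
  ; _⁻¹     = flip
  ; isGroup = record
    { isMonoid = record
      { isSemigroup = record
        { isMagma = record
          { isEquivalence = record
            { refl  = λ _ → refl
            ; sym   = λ p i → sym (p i)
            ; trans = λ p q i → trans (p i) (q i)
            }
          ; ∙-cong = λ {g} {_} {_} {t} p q i →
              trans (cong (g ⟨$⟩ʳ_) (q i)) (p (t ⟨$⟩ʳ i))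
          }
        ; assoc = λ _ _ _ _ → refl
        }
      ; identity = (λ _ _ → refl) , (λ _ _ → refl)
      }
    ; inverse = (λ g _ → inverseˡ g) , (λ g _ → inverseʳ g)
    ; ⁻¹-cong = λ {g} {h} p i →
        trans (cong (g ⟨$⟩ˡ_) (sym (trans (p (h ⟨$⟩ˡ i)) (inverseʳ h))))
              (inverseˡ g)
    }
  }

mirror-< : ∀ {j k} → k < j → j ∸ ℕ.suc k < j
mirror-< {ℕ.suc j} {k} (s≤s k≤j) = s≤s (m∸n≤m j k)

mirror-mirror : ∀ {j k} → k < j → j ∸ ℕ.suc (j ∸ ℕ.suc k) ≡ k
mirror-mirror {ℕ.suc j} {k} (s≤s k≤j) = m∸[m∸n]≡n k≤j

-- Positions are counted from 0, so k ↦ j + 1 − k on {1,…,j} becomes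
-- k ↦ j − 1 − k on {0,…,j−1}.
reversePrefix : ∀ {n} (j : ℕ) → j ≤ n → Fin n → Fin n
reversePrefix j j≤n k with toℕ k <? j
... | yes k<j = fromℕ< (<-≤-trans (mirror-< k<j) j≤n)
... | no  _   = k

toℕ-reversePrefix : ∀ {n} (j : ℕ) (j≤n : j ≤ n) (k : Fin n) → toℕ k < j →
                    toℕ (reversePrefix j j≤n k) ≡ j ∸ ℕ.suc (toℕ k)
toℕ-reversePrefix j j≤n k k<j with toℕ k <? j
... | yes _   = toℕ-fromℕ< _
... | no  k≮j = contradiction k<j k≮j

reversePrefix-fixes : ∀ {n} (j : ℕ) (j≤n : j ≤ n) (k : Fin n) → ¬ (toℕ k < j) →
                      reversePrefix j j≤n k ≡ k
reversePrefix-fixes j j≤n k k≮j with toℕ k <? j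
... | yes k<j = contradiction k<j k≮j
... | no  _   = refl

reversePrefix-involutive : ∀ {n} (j : ℕ) (j≤n : j ≤ n) (k : Fin n) →
                           reversePrefix j j≤n (reversePrefix j j≤n k) ≡ k
reversePrefix-involutive {n} j j≤n k = go (toℕ k <? j)
  where
  ρ : Fin n → Fin n
  ρ = reversePrefix j j≤n

  go : Dec (toℕ k < j) → ρ (ρ k) ≡ k
  go (no k≮j)  = trans (cong ρ (reversePrefix-fixes j j≤n k k≮j))
                       (reversePrefix-fixes j j≤n k k≮j)
  go (yes k<j) = toℕ-injective (trans
    (toℕ-reversePrefix j j≤n (ρ k) (subst (_< j) (sym eq) (mirror-< k<j)))
    (trans (cong (λ m → j ∸ ℕ.suc m) eq) (mirror-mirror k<j)))
    where
    eq : toℕ (ρ k) ≡ j ∸ ℕ.suc (toℕ k)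
    eq = toℕ-reversePrefix j j≤n k k<j

r₁ : ∀ {n} (j : ℕ) → j ≤ n → Permutation′ n
r₁ j j≤n = permutation (reversePrefix j j≤n) (reversePrefix j j≤n)
             (reversePrefix-involutive j j≤n) (reversePrefix-involutive j j≤n)

PR : ∀ n → Pred (Permutation′ n) 0ℓ
PR n s = ∃[ j ] (2 ≤ j × Σ[ j≤n ∈ j ≤ n ] s Perm.≈ r₁ j j≤n)

id∉PR : ∀ n (s : Permutation′ n) → PR n s → ¬ (s Perm.≈ Perm.id)
id∉PR (ℕ.suc n) s (ℕ.suc (ℕ.suc j) , s≤s (s≤s z≤n) , j≤n , s≈r) s≈id
  with () ← trans (sym (toℕ-reversePrefix (ℕ.suc (ℕ.suc j)) j≤n Fin.zero (s≤s z≤n)))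
                  (cong toℕ (trans (sym (s≈r Fin.zero)) (s≈id Fin.zero)))

Pancake : ℕ → SimpleGraph 0ℓ 0ℓ 0ℓ
Pancake n = Cay (Sym n) (PR n) (id∉PR n)

module Submission where

-- Write ρ p for the reversal of the positions 0, …, p (the generator with label p); the
-- neighbours of g are the g ρ p with p ≥ 1, so an automorphism φ sends each labelled edge
-- at g to a labelled edge at φ g. If it preserves all labels it commutes with all right
-- multiplications by generators, hence it is the left translation by φ 1.
-- In a closed non-backtracking walk of length 6, following the position equal to the
-- largest label shows that all labels are 1 or 2. Hence φ preserves the set of the edges
-- labelled 1 or 2, and right multiplication by x = ρ 1 ρ 2 ρ 1 = ρ 2 ρ 1 ρ 2 = (1 2), the
-- antipode in such a hexagon. Since ρ 3 x ρ 3 = x, the label 3 is preserved, and since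
-- ρ (m + 1) x ρ (m + 1) = ρ m ρ 1 ρ m, label m being preserved forces the same for label
-- m + 1, and label 1 to be told apart from label 2; here the label 4, hence n ≥ 5, is needed.

open import Defs
open import Algebra.Bundles using (Group)
open import Data.Nat.Base using (ℕ; zero; suc; _+_; _∸_; _≤_; _<_; _<ᵇ_; z≤n; s≤s; s≤s⁻¹; z<s)
open import Data.Nat.Properties
open import Data.Bool.Base using (if_then_else_; true; false; T)
open import Data.Unit.Base using (tt)
open import Data.Fin.Base as Fin using (Fin; toℕ; fromℕ<; inject₁)
open import Data.Fin.Patterns using (0F; 1F; 2F)
open import Data.Fin.Properties using (toℕ-injective; toℕ-fromℕ<; toℕ<n; toℕ-inject₁)
open import Data.Fin.Induction using (<-weakInduction)
open import Data.Fin.Permutation as Perm using (Permutation′; _⟨$⟩ʳ_; _⟨$⟩ˡ_; inverseˡ; inverseʳ)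
open import Data.List.Base using (List; []; _∷_; foldl)
open import Data.Product.Base using (∃-syntax; _×_; _,_; proj₁; proj₂)
open import Data.Sum.Base using (_⊎_; inj₁; inj₂)
open import Function.Base using (_∘_)
open import Function.Bundles using (Inverse; Equivalence; mk⇔)
open import Relation.Binary.PropositionalEquality
open import Relation.Nullary using (¬_; contradiction)
open import Relation.Unary using (_≐_)

-- Prefix reversals as functions on the natural numbers.

-- Matching on x keeps ρ p x from unfolding on open terms, which would copy x three times.
ρ : ℕ → ℕ → ℕ
ρ p zero    = p
ρ p (suc x) = if x <ᵇ p then p ∸ suc x else suc x

ρ-reverses : ∀ {p x} → x ≤ p → ρ p x ≡ p ∸ x
ρ-reverses {p} {zero}  _   = refl
ρ-reverses {p} {suc x} x<p with x <ᵇ p in eq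
... | true  = refl
... | false = contradiction (subst T eq (<⇒<ᵇ x<p)) λ ()

ρ-fixes : ∀ {p x} → p < x → ρ p x ≡ x
ρ-fixes {p} {suc x} p<1+x with x <ᵇ p in eq
... | false = refl
... | true  = contradiction (<ᵇ⇒< x p (subst T (sym eq) tt)) (≤⇒≯ (s≤s⁻¹ p<1+x))

ρ-+ : ∀ {p} x y → x + y ≡ p → ρ p x ≡ y
ρ-+ x y refl = trans (ρ-reverses (m≤m+n x y)) (m+n∸m≡n x y)

ρ-top : ∀ p → ρ p p ≡ 0
ρ-top p = ρ-+ p 0 (+-identityʳ p)

ρ-≤ : ∀ {p x} → x ≤ p → ρ p x ≤ p
ρ-≤ {p} {x} x≤p = subst (_≤ p) (sym (ρ-reverses x≤p)) (m∸n≤m p x)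

ρ-involutive : ∀ p x → ρ p (ρ p x) ≡ x
ρ-involutive p x with ≤-<-connex x p
... | inj₁ x≤p = trans (cong (ρ p) (ρ-reverses x≤p)) (ρ-+ (p ∸ x) x (m∸n+n≡m x≤p))
... | inj₂ p<x = trans (cong (ρ p) (ρ-fixes p<x)) (ρ-fixes p<x)

ρ-transpose : ∀ p {x y} → ρ p x ≡ y → x ≡ ρ p y
ρ-transpose p {x} eq = trans (sym (ρ-involutive p x)) (cong (ρ p) eq)

ρ-0 : ∀ {p x} → ρ p x ≡ 0 → x ≡ p
ρ-0 {p} = ρ-transpose p

ρ-top⁻¹ : ∀ {p x} → ρ p x ≡ p → x ≡ 0
ρ-top⁻¹ {p} eq = trans (ρ-transpose p eq) (ρ-top p)

-- Closed non-backtracking walks of length 6.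

record Hexagon (a b c d e f : ℕ) : Set where
  field
    a>0 : 0 < a
    b>0 : 0 < b
    c>0 : 0 < c
    d>0 : 0 < d
    e>0 : 0 < e
    f>0 : 0 < f
    a≢b : a ≢ b
    b≢c : b ≢ c
    c≢d : c ≢ d
    d≢e : d ≢ e
    e≢f : e ≢ f
    f≢a : f ≢ a
    closed : ∀ z → ρ a (ρ b (ρ c (ρ d (ρ e (ρ f z))))) ≡ z

-- Conjugating the closing relation by `ρ a` moves the first label to the end, so that the lemmas
-- below may assume that the first label is the top one.
rotate : ∀ {a b c d e f} → Hexagon a b c d e f → Hexagon b c d e f a
rotate {a} H = record
  { a>0 = b>0 ; b>0 = c>0 ; c>0 = d>0 ; d>0 = e>0 ; e>0 = f>0 ; f>0 = a>0
  ; a≢b = b≢c ; b≢c = c≢d ; c≢d = d≢e ; d≢e = e≢f ; e≢f = f≢a ; f≢a = a≢b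
  ; closed = λ z → trans (ρ-transpose a (closed (ρ a z))) (ρ-involutive a z)
  }
  where open Hexagon H

record Bounded (k a b c d e f : ℕ) : Set where
  constructor bounded
  field
    a≤ : a ≤ k
    b≤ : b ≤ k
    c≤ : c ≤ k
    d≤ : d ≤ k
    e≤ : e ≤ k
    f≤ : f ≤ k

rotateᵇ : ∀ {k a b c d e f} → Bounded k a b c d e f → Bounded k b c d e f a
rotateᵇ (bounded a b c d e f) = bounded b c d e f a

ρ-fixes₂ : ∀ {a b k} → a < k → b < k → ρ a (ρ b k) ≡ k
ρ-fixes₂ {a} a<k b<k = trans (cong (ρ a) (ρ-fixes b<k)) (ρ-fixes a<k)

ρ-fixes₃ : ∀ {a b c k} → a < k → b < k → c < k → ρ a (ρ b (ρ c k)) ≡ k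
ρ-fixes₃ {a} a<k b<k c<k = trans (cong (ρ a) (ρ-fixes₂ b<k c<k)) (ρ-fixes a<k)

lower-top : ∀ {k x} → x ≡ k → ρ k x ≡ 0
lower-top {k} refl = ρ-top k

-- All the lemmas on hexagons follow the orbit of the top position k.
one-top : ∀ {k b c d e f} → Hexagon k b c d e f →
          b < k → c < k → d < k → e < k → ¬ f < k
one-top {k} {b} {c} {d} {e} {f} H b<k c<k d<k e<k f<k =
  <⇒≢ a>0 (trans (sym (ρ-top k)) (trans (cong (ρ k) (sym fixed)) (closed k)))
  where
  open Hexagon H
  fixed : ρ b (ρ c (ρ d (ρ e (ρ f k)))) ≡ k
  fixed = trans (cong (ρ b ∘ ρ c) (ρ-fixes₃ d<k e<k f<k)) (ρ-fixes₂ b<k c<k)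

-- The top `k` stays put until the inner `ρ k` sends it to 0, and `ρ b` sends 0 to `b`. The outer
-- `ρ k` brings `b` back to `k` only if `b` is 0.
two-tops-at-distance-2 : ∀ {k b d e f} → Hexagon k b k d e f → d < k → e < k → ¬ f < k
two-tops-at-distance-2 {k} {b} {d} {e} {f} H d<k e<k f<k = <⇒≢ b>0 (sym (ρ-top⁻¹
  (trans (cong (ρ k ∘ ρ b) (sym (lower-top (ρ-fixes₃ d<k e<k f<k)))) (closed k))))
  where open Hexagon H

-- Here the top passes through 0 and `c`, and `ρ b` must take `c` to 0, which forces the adjacent
-- labels `b` and `c` to agree.
two-tops-at-distance-3 : ∀ {k b c e f} → Hexagon k b c k e f → e < k → ¬ f < k
two-tops-at-distance-3 {k} {b} {c} {e} {f} H e<k f<k = b≢c (sym (ρ-0 {b} {c} (ρ-top⁻¹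
  (trans (cong (ρ k ∘ ρ b ∘ ρ c) (sym (lower-top (ρ-fixes₂ e<k f<k)))) (closed k)))))
  where open Hexagon H

-- The top passes through 0, `d` and `k - d`, which `ρ b` must take to 0.
three-tops-sum : ∀ {k b d f} → Hexagon k b k d k f → d < k → f < k → b + d ≡ k
three-tops-sum {k} {b} {d} {f} H d<k f<k = trans (cong (_+ d) (sym k∸d≡b)) (m∸n+n≡m (<⇒≤ d<k))
  where
  open Hexagon H
  ρd≡b : ρ k d ≡ b
  ρd≡b = ρ-0 {b} (ρ-top⁻¹ {k}
    (trans (cong (ρ k ∘ ρ b ∘ ρ k ∘ ρ d) (sym (lower-top (ρ-fixes f<k)))) (closed k)))
  k∸d≡b : k ∸ d ≡ b
  k∸d≡b = trans (sym (ρ-reverses (<⇒≤ d<k))) ρd≡b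

-- With `k = b + b`, position 1 travels through `b - 1`, `b + 1`, `b + 1`, `b - 1`, 1 and ends at
-- `k - 1`, which is at least 3. The value `b = 1` would give the genuine hexagon.
alternating : ∀ {b} → 2 ≤ b → ¬ Hexagon (b + b) b (b + b) b (b + b) b
alternating {suc (suc j)} (s≤s (s≤s z≤n)) H =
  contradiction (trans (suc-injective (trans (sym (Hexagon.closed H 1)) track)) (+-suc j (suc j))) λ ()
  where
  b k : ℕ
  b = 2 + j
  k = b + b
  k-1+j : ρ k (1 + j) ≡ 3 + j
  k-1+j = ρ-+ (1 + j) (3 + j) (+-suc (1 + j) (2 + j))
  k-3+j : ρ k (3 + j) ≡ 1 + j
  k-3+j = trans (cong (ρ k) (sym k-1+j)) (ρ-involutive k (1 + j))
  b-1+j : ρ b (1 + j) ≡ 1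
  b-1+j = ρ-+ (1 + j) 1 (+-comm (1 + j) 1)
  track : ρ k (ρ b (ρ k (ρ b (ρ k (ρ b 1))))) ≡ 1 + j + b
  track = begin
    ρ k (ρ b (ρ k (ρ b (ρ k (1 + j)))))  ≡⟨ cong (ρ k ∘ ρ b ∘ ρ k ∘ ρ b) k-1+j ⟩
    ρ k (ρ b (ρ k (ρ b (3 + j))))        ≡⟨ cong (ρ k ∘ ρ b ∘ ρ k) (ρ-fixes (n<1+n b)) ⟩
    ρ k (ρ b (ρ k (3 + j)))              ≡⟨ cong (ρ k ∘ ρ b) k-3+j ⟩
    ρ k (ρ b (1 + j))                    ≡⟨ cong (ρ k) b-1+j ⟩
    ρ k 1                                ≡⟨⟩
    1 + j + b                            ∎
    where open ≡-Reasoning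

-- Applied to three rotations, `three-tops-sum` makes the pairwise sums of `b`, `d` and `f` equal to
-- `k`, so all three are half of `k`.
three-tops : ∀ {k b d f} → 3 ≤ k → Hexagon k b k d k f → b < k → d < k → ¬ f < k
three-tops {k} {b} {d} {f} 3≤k H b<k d<k f<k = go b≡d f≡d b+d≡k
  where
  b+d≡k : b + d ≡ k
  b+d≡k = three-tops-sum H d<k f<k
  d+f≡k : d + f ≡ k
  d+f≡k = three-tops-sum (rotate (rotate H)) f<k b<k
  f+b≡k : f + b ≡ k
  f+b≡k = three-tops-sum (rotate (rotate (rotate (rotate H)))) b<k d<k
  b≡d : b ≡ d
  b≡d = +-cancelˡ-≡ f b d (trans f+b≡k (trans (sym d+f≡k) (+-comm d f)))
  f≡d : f ≡ d
  f≡d = +-cancelʳ-≡ b f d (trans f+b≡k (trans (sym b+d≡k) (+-comm b d)))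
  2≤half : ∀ n → 3 ≤ n + n → 2 ≤ n
  2≤half (suc zero)    (s≤s (s≤s ()))
  2≤half (suc (suc n)) _ = s≤s (s≤s z≤n)
  go : b ≡ d → f ≡ d → ¬ (b + d ≡ k)
  go refl refl refl = alternating (2≤half b 3≤k) H

-- Neighbours of a top label are not top, so up to rotation only four patterns of tops remain: one,
-- two at distance 2, two at distance 3, and three alternating.
not-top : ∀ {k a b c d e f} → 3 ≤ k → Bounded k a b c d e f → Hexagon a b c d e f → a ≢ k
not-top {k} {_} {b} {c} {d} {e} {f} 3≤k B H refl =
  go (m≤n⇒m<n∨m≡n c≤) (m≤n⇒m<n∨m≡n d≤) (m≤n⇒m<n∨m≡n e≤)
  where
  open Hexagon H
  open Bounded B
  b<k : b < k
  b<k = ≤∧≢⇒< b≤ (a≢b ∘ sym)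
  f<k : f < k
  f<k = ≤∧≢⇒< f≤ f≢a
  go : c < k ⊎ c ≡ k → d < k ⊎ d ≡ k → ¬ (e < k ⊎ e ≡ k)
  go (inj₁ c<k)  (inj₁ d<k)  (inj₁ e<k)  = one-top H b<k c<k d<k e<k f<k
  go (inj₁ c<k)  (inj₁ d<k)  (inj₂ refl) =
    two-tops-at-distance-2 (rotate (rotate (rotate (rotate H)))) b<k c<k d<k
  go (inj₁ c<k)  (inj₂ refl) (inj₁ e<k)  = two-tops-at-distance-3 H e<k f<k
  go (inj₁ c<k)  (inj₂ refl) (inj₂ refl) = d≢e refl
  go (inj₂ refl) (inj₁ d<k)  (inj₁ e<k)  = two-tops-at-distance-2 H d<k e<k f<k
  go (inj₂ refl) (inj₁ d<k)  (inj₂ refl) = three-tops 3≤k H b<k d<k f<k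
  go (inj₂ refl) (inj₂ refl) _           = c≢d refl

Bounded-pred : ∀ {k a b c d e f} → 2 ≤ k → Hexagon a b c d e f →
               Bounded (suc k) a b c d e f → Bounded k a b c d e f
Bounded-pred {k} 2≤k H₀ B₀ = bounded (below B₀ H₀) (below B₁ H₁) (below B₂ H₂)
                                     (below B₃ H₃) (below B₄ H₄) (below B₅ H₅)
  where
  below : ∀ {a b c d e f} → Bounded (suc k) a b c d e f → Hexagon a b c d e f → a ≤ k
  below B H = s≤s⁻¹ (≤∧≢⇒< (Bounded.a≤ B) (not-top (s≤s 2≤k) B H))
  H₁ = rotate H₀
  H₂ = rotate H₁
  H₃ = rotate H₂
  H₄ = rotate H₃
  H₅ = rotate H₄
  B₁ = rotateᵇ B₀
  B₂ = rotateᵇ B₁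
  B₃ = rotateᵇ B₂
  B₄ = rotateᵇ B₃
  B₅ = rotateᵇ B₄

-- Descent on a common bound of the labels: a bound of at least 3 is never attained.
hexagon-labels : ∀ k {a b c d e f} → Hexagon a b c d e f →
                 Bounded (k + 2) a b c d e f → Bounded 2 a b c d e f
hexagon-labels zero    H B = B
hexagon-labels (suc k) H B = hexagon-labels k H (Bounded-pred (m≤n+m 2 k) H B)

-- The transposition of 1 and 2 and its conjugates by reversals.

swap₁₂ : ℕ → ℕ
swap₁₂ z = ρ 1 (ρ 2 (ρ 1 z))

braid : ∀ z → ρ 2 (ρ 1 (ρ 2 z)) ≡ swap₁₂ z
braid 0 = refl
braid 1 = refl
braid 2 = refl
braid (suc (suc (suc z))) = refl

swap₁₂-fixes : ∀ {z} → 3 ≤ z → swap₁₂ z ≡ z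
swap₁₂-fixes (s≤s (s≤s (s≤s z≤n))) = refl

-- Both sides are the transposition of m and m - 1, where m = 2 + j.
conjugate-swap : ∀ j z → ρ (3 + j) (swap₁₂ (ρ (3 + j) z)) ≡ ρ (2 + j) (ρ 1 (ρ (2 + j) z))
conjugate-swap j z with ≤-<-connex z (3 + j)
... | inj₂ m<z = trans (lhs-fixes m<z) (sym (trans (cong (ρ (2 + j) ∘ ρ 1) (ρ-fixes m′<z))
                   (ρ-fixes₂ m′<z (≤-trans (s≤s (s≤s z≤n)) m<z))))
  where
  m′<z : 2 + j < z
  m′<z = ≤-trans (n≤1+n _) m<z
  lhs-fixes : 3 + j < z → ρ (3 + j) (swap₁₂ (ρ (3 + j) z)) ≡ z
  lhs-fixes lt = trans (cong (ρ (3 + j) ∘ swap₁₂) (ρ-fixes lt))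
    (trans (cong (ρ (3 + j)) (swap₁₂-fixes (≤-trans (s≤s (s≤s (s≤s z≤n))) lt))) (ρ-fixes lt))
-- `t` is the reflection of `z`, and `swap₁₂` moves it only when it is 1 or 2. The case of 0 is
-- apart because there `ρ (2 + j)` fixes `z`.
... | inj₁ z≤m = go (3 + j ∸ z) (m+[n∸m]≡n z≤m)
  where
  go : ∀ t → z + t ≡ 3 + j → ρ (3 + j) (swap₁₂ (ρ (3 + j) z)) ≡ ρ (2 + j) (ρ 1 (ρ (2 + j) z))
  go 0 eq with refl ← trans (sym (+-identityʳ z)) eq =
    trans (cong (ρ (3 + j) ∘ swap₁₂) (ρ-top (3 + j)))
      (sym (trans (cong (ρ (2 + j) ∘ ρ 1) (ρ-fixes (n<1+n (2 + j)))) (ρ-fixes (n<1+n (2 + j)))))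
  go 1 eq with refl ← suc-injective (trans (+-comm 1 z) eq) =
    trans (cong (ρ (3 + j) ∘ swap₁₂) (ρ-+ (2 + j) 1 eq))
      (sym (cong (ρ (2 + j) ∘ ρ 1) (ρ-top (2 + j))))
  go 2 eq with refl ← suc-injective (suc-injective (trans (+-comm 2 z) eq)) =
    trans (cong (ρ (3 + j) ∘ swap₁₂) (ρ-+ (1 + j) 2 eq))
      (sym (cong (ρ (2 + j) ∘ ρ 1) (ρ-+ (1 + j) 1 (+-comm (1 + j) 1))))
  go (suc (suc (suc t))) eq =
    trans (cong (ρ (3 + j) ∘ swap₁₂) (ρ-+ z (3 + t) eq))
      (trans (ρ-+ (3 + t) z (trans (+-comm (3 + t) z) eq))
        (sym (trans (cong (ρ (2 + j) ∘ ρ 1) (ρ-+ z (2 + t) eq′))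
          (ρ-+ (2 + t) z (trans (+-comm (2 + t) z) eq′)))))
    where
    eq′ : z + (2 + t) ≡ 2 + j
    eq′ = suc-injective (trans (sym (+-suc z (2 + t))) eq)

conjugate-at-label : ∀ k l → ρ k (swap₁₂ (ρ l l)) ≡ k
conjugate-at-label k l = cong (ρ k ∘ swap₁₂) (ρ-top l)

conjugate-below-label : ∀ p → ρ (3 + p) (swap₁₂ (ρ (3 + p) (2 + p))) ≡ 1 + p
conjugate-below-label p = cong (ρ (3 + p) ∘ swap₁₂) (ρ-+ (2 + p) 1 (+-comm (2 + p) 1))

-- `k` and `l` will be the images of label 3 at two vertices, so they are not known to agree. At `l`
-- the hypothesis reads `k ≡ swap₁₂ l`, and `3 ≤ k` leaves `k ≡ l`. If `l` exceeds 3, the left side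
-- moves `l - 1` and the right side fixes it.
label-of-conjugate₃ : ∀ {k l} → 3 ≤ k → (∀ z → ρ k (swap₁₂ (ρ l z)) ≡ swap₁₂ z) → k ≡ 3
label-of-conjugate₃ {k} {l} 3≤k h = go l 3≤k h (trans (sym (conjugate-at-label k l)) (h l))
  where
  go : ∀ l → 3 ≤ k → (∀ z → ρ k (swap₁₂ (ρ l z)) ≡ swap₁₂ z) → k ≡ swap₁₂ l → k ≡ 3
  go 0 () h refl
  go 1 (s≤s (s≤s ())) h refl
  go 2 (s≤s ()) h refl
  go 3 _ h eq = eq
  go (suc (suc (suc (suc p)))) _ h refl = contradiction
    (trans (sym (h (3 + p))) (conjugate-below-label (1 + p))) 1+n≢n

-- `s` stands for the unknown image of label 1, and `k`, `l` for the images of label `4 + t` at two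
-- vertices. The conclusion on `s` is what tells label 1 from label 2.
label-of-conjugate : ∀ t {k l s} → 1 ≤ s → s ≤ 2 →
  (∀ z → ρ k (swap₁₂ (ρ l z)) ≡ ρ (3 + t) (ρ s (ρ (3 + t) z))) → k ≡ 4 + t × s ≡ 1
label-of-conjugate t {k} {l} {s} 1≤s s≤2 h = cases (≤-<-connex l m)
  where
  m : ℕ
  m = 3 + t
  s≤m : s ≤ m
  s≤m = ≤-trans s≤2 (s≤s (s≤s z≤n))
  s<m : s < m
  s<m = s≤s (≤-trans s≤2 (s≤s (s≤s z≤n)))
  at-l : k ≡ ρ m (ρ s (ρ m l))
  at-l = trans (sym (cong (ρ k ∘ swap₁₂) (ρ-top l))) (h l)
  rhs-m : ρ m (ρ s (ρ m m)) ≡ m ∸ s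
  rhs-m = trans (cong (ρ m ∘ ρ s) (ρ-top m)) (ρ-reverses s≤m)
  m∸s<m : m ∸ s < m
  m∸s<m = ∸-monoʳ-< 1≤s s≤m
  rhs-low : ∀ {z} → z ≤ m → ρ m (ρ s (ρ m z)) ≤ m
  rhs-low {z} z≤m with ≤-<-connex (ρ m z) s
  ... | inj₁ ≤s = ρ-≤ {m} {ρ s (ρ m z)} (≤-trans (ρ-≤ {s} {ρ m z} ≤s) s≤m)
  ... | inj₂ s< = ρ-≤ {m} {ρ s (ρ m z)} (subst (_≤ m) (sym (ρ-fixes s<)) (ρ-≤ {m} {z} z≤m))
  rhs-high : ∀ {z} → m < z → ρ m (ρ s (ρ m z)) ≡ z
  rhs-high m<z = trans (cong (ρ m ∘ ρ s) (ρ-fixes m<z)) (ρ-fixes₂ m<z (<-trans s<m m<z))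



  -- If `m < l`, the right side fixes `l`, whence `k ≡ l`. If moreover `m + 1 < l`, the right side
  -- fixes `l - 1` but the left side moves it.
  above : ∀ e → l ≡ 4 + (e + t) → k ≡ l → k ≡ 4 + t × s ≡ 1
  above (suc e) refl refl = contradiction
    (trans (sym (rhs-high (s≤s (s≤s (s≤s (s≤s (m≤n+m t e)))))))
      (trans (sym (h (4 + (e + t)))) (conjugate-below-label (2 + (e + t))))) 1+n≢n
  -- For `l ≡ m + 1`, position `m` goes to `m - 1` on the left and to `m - s` on the right.
  above zero refl refl = refl ,
    s≡1 s 1≤s s≤2 (trans (sym (conjugate-below-label (1 + t))) (trans (h m) rhs-m))
    where
    s≡1 : ∀ s → 1 ≤ s → s ≤ 2 → 2 + t ≡ m ∸ s → s ≡ 1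
    s≡1 1 _ _ _ = refl
    s≡1 2 _ _ eq = contradiction eq 1+n≢n
    s≡1 (suc (suc (suc _))) _ (s≤s (s≤s ())) _

  -- One evaluation refutes each case: at 0 for `k < m` and `l ≡ m`, at `m` for the other three.
  not-below : k < m ⊎ k ≡ m → ¬ (l < m ⊎ l ≡ m)
  not-below (inj₁ k<m) (inj₁ l<m) = <⇒≢ m∸s<m (sym (trans (sym lhs) (trans (h m) rhs-m)))
    where
    lhs : ρ k (swap₁₂ (ρ l m)) ≡ m
    lhs = trans (cong (ρ k ∘ swap₁₂) (ρ-fixes l<m)) (ρ-fixes k<m)
  not-below (inj₁ k<m) (inj₂ refl) = contradiction (trans (sym (ρ-fixes k<m)) (trans (h 0) rhs-0)) λ ()
    where
    rhs-0 : ρ m (ρ s m) ≡ 0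
    rhs-0 = trans (cong (ρ m) (ρ-fixes s<m)) (ρ-top m)
  not-below (inj₂ refl) (inj₁ l<m) = <⇒≢ (m<n⇒0<n∸m s<m) (trans (sym lhs) (trans (h m) rhs-m))
    where
    lhs : ρ m (swap₁₂ (ρ l m)) ≡ 0
    lhs = trans (cong (ρ m ∘ swap₁₂) (ρ-fixes l<m)) (ρ-top m)
  not-below (inj₂ refl) (inj₂ refl) = <⇒≢ m∸s<m (sym (trans at-l rhs-m))

  cases : l ≤ m ⊎ m < l → k ≡ 4 + t × s ≡ 1
  cases (inj₂ m<l) with e , eq ← m≤n⇒∃[o]m+o≡n m<l =
    above e (trans (sym eq) (cong (4 +_) (+-comm t e))) (trans at-l (rhs-high m<l))
  cases (inj₁ l≤m) = contradiction (m≤n⇒m<n∨m≡n l≤m) (not-below (m≤n⇒m<n∨m≡n k≤m))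
    where
    k≤m : k ≤ m
    k≤m = subst (_≤ m) (sym at-l) (rhs-low l≤m)

-- Words in the generators and the labelled edges of the pancake graph.

-- The label q : Fin d stands for the reversal of the positions 0, …, q + 1.
# : ∀ {d} → Fin d → ℕ
# q = suc (toℕ q)

#-injective : ∀ {d} {p q : Fin d} → # p ≡ # q → p ≡ q
#-injective = toℕ-injective ∘ suc-injective

-- The first letter acts last on positions, which matches multiplying a vertex on the right by the
-- letters in reading order.
evaluate : ∀ {d} → List (Fin d) → ℕ → ℕ
evaluate []       z = z
evaluate (q ∷ ws) z = ρ (# q) (evaluate ws z)

evaluate-fixes : ∀ {d} (ws : List (Fin d)) {z} → d < z → evaluate ws z ≡ z
evaluate-fixes []       d<z = refl
evaluate-fixes (q ∷ ws) d<z =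
  trans (cong (ρ (# q)) (evaluate-fixes ws d<z)) (ρ-fixes (≤-<-trans (toℕ<n q) d<z))

toℕ-reversePrefix-ρ : ∀ {n} p (p<n : p < n) (i : Fin n) →
                      toℕ (reversePrefix (suc p) p<n i) ≡ ρ p (toℕ i)
toℕ-reversePrefix-ρ p p<n i with ≤-<-connex (toℕ i) p
... | inj₁ i≤p = trans (toℕ-reversePrefix (suc p) p<n i (s≤s i≤p)) (sym (ρ-reverses i≤p))
... | inj₂ p<i = trans (cong toℕ (reversePrefix-fixes (suc p) p<n i (λ i<1+p → <⇒≱ p<i (s≤s⁻¹ i<1+p))))
                       (sym (ρ-fixes p<i))

module _ {d : ℕ} where
  private
    V = Permutation′ (suc d)
    module S = Group (Sym (suc d))

  infixl 7 _·_ _·*_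

  -- Opaque because conversion checking would otherwise compare the proofs inside products.
  opaque
    _·_ : V → Fin d → V
    g · q = g S.∙ r₁ (suc (# q)) (s≤s (toℕ<n q))

  _·*_ : V → List (Fin d) → V
  _·*_ = foldl _·_

  opaque
    unfolding _·_

    ·-cong : ∀ (g h : V) q → g Perm.≈ h → g · q Perm.≈ h · q
    ·-cong g h q eq i = eq _

    ·-involutive : ∀ (g : V) q → g · q · q Perm.≈ g
    ·-involutive g q i = cong (g ⟨$⟩ʳ_) (reversePrefix-involutive (suc (# q)) (s≤s (toℕ<n q)) i)

  ·*-cong : ∀ (g h : V) ws → g Perm.≈ h → g ·* ws Perm.≈ h ·* ws
  ·*-cong g h []       eq = eq
  ·*-cong g h (q ∷ ws) eq = ·*-cong (g · q) (h · q) ws (·-cong g h q eq)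

  follow : List (Fin d) → Fin (suc d) → Fin (suc d)
  follow []       i = i
  follow (q ∷ ws) i = reversePrefix (suc (# q)) (s≤s (toℕ<n q)) (follow ws i)

  toℕ-follow : ∀ ws i → toℕ (follow ws i) ≡ evaluate ws (toℕ i)
  toℕ-follow []       i = refl
  toℕ-follow (q ∷ ws) i = trans (toℕ-reversePrefix-ρ (# q) (s≤s (toℕ<n q)) (follow ws i))
                                (cong (ρ (# q)) (toℕ-follow ws i))

  opaque
    unfolding _·_

    ·*-follow : ∀ (g : V) ws i → (g ·* ws) ⟨$⟩ʳ i ≡ g ⟨$⟩ʳ follow ws i
    ·*-follow g []       i = refl
    ·*-follow g (q ∷ ws) i = ·*-follow (g · q) ws i

  evaluate⇒≈ : ∀ (g : V) ws vs → (∀ z → evaluate ws z ≡ evaluate vs z) → g ·* ws Perm.≈ g ·* vs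
  evaluate⇒≈ g ws vs eq i = begin
    (g ·* ws) ⟨$⟩ʳ i    ≡⟨ ·*-follow g ws i ⟩
    g ⟨$⟩ʳ follow ws i  ≡⟨ cong (g ⟨$⟩ʳ_) (toℕ-injective
      (trans (toℕ-follow ws i) (trans (eq (toℕ i)) (sym (toℕ-follow vs i))))) ⟩
    g ⟨$⟩ʳ follow vs i  ≡⟨ ·*-follow g vs i ⟨
    (g ·* vs) ⟨$⟩ʳ i    ∎
    where open ≡-Reasoning

  -- Left cancellation of `g` gives equality on the positions up to `d`; beyond them every word acts
  -- trivially.
  ≈⇒evaluate : ∀ (g : V) ws vs → g ·* ws Perm.≈ g ·* vs → ∀ z → evaluate ws z ≡ evaluate vs z
  ≈⇒evaluate g ws vs eq z with ≤-<-connex z d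
  ... | inj₂ d<z = trans (evaluate-fixes ws d<z) (sym (evaluate-fixes vs d<z))
  ... | inj₁ z≤d = begin
    evaluate ws z        ≡⟨ cong (evaluate ws) toℕ-i ⟨
    evaluate ws (toℕ i)  ≡⟨ toℕ-follow ws i ⟨
    toℕ (follow ws i)    ≡⟨ cong toℕ follow≡ ⟩
    toℕ (follow vs i)    ≡⟨ toℕ-follow vs i ⟩
    evaluate vs (toℕ i)  ≡⟨ cong (evaluate vs) toℕ-i ⟩
    evaluate vs z        ∎
    where
    open ≡-Reasoning
    i : Fin (suc d)
    i = fromℕ< (s≤s z≤d)
    toℕ-i : toℕ i ≡ z
    toℕ-i = toℕ-fromℕ< (s≤s z≤d)
    follow≡ : follow ws i ≡ follow vs i
    follow≡ = trans (sym (inverseˡ g)) (trans (cong (g ⟨$⟩ˡ_)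
      (trans (sym (·*-follow g ws i)) (trans (eq i) (·*-follow g vs i)))) (inverseˡ g))

  label-injective : ∀ (g : V) p q → g · p Perm.≈ g · q → p ≡ q
  -- A reversal sends position 0 to its label.
  label-injective g p q eq = #-injective (≈⇒evaluate g (p ∷ []) (q ∷ []) eq 0)

  open SimpleGraph (Pancake (suc d)) using (Adj)

  opaque
    unfolding _·_

    ·-adjacent : ∀ (g : V) q → Adj g (g · q)
    ·-adjacent g q = r₁ (suc (# q)) (s≤s (toℕ<n q)) ,
      (suc (# q) , s≤s z<s , s≤s (toℕ<n q) , λ _ → refl) , inj₁ λ _ → refl

  generator : ∀ s → PR (suc d) s → ∃[ q ] s Perm.≈ r₁ (suc (# q)) (s≤s (toℕ<n q))
  generator s (suc (suc j) , s≤s (s≤s z≤n) , j≤n , s≈r) = q , λ i → trans (s≈r i) (toℕ-injective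
    (trans (toℕ-reversePrefix-ρ (suc j) j≤n i) (trans (cong (λ k → ρ (suc k) (toℕ i)) (sym toℕ-q))
      (sym (toℕ-reversePrefix-ρ (# q) (s≤s (toℕ<n q)) i)))))
    where
    q : Fin d
    q = fromℕ< (s≤s⁻¹ j≤n)
    toℕ-q : toℕ q ≡ j
    toℕ-q = toℕ-fromℕ< (s≤s⁻¹ j≤n)

  opaque
    unfolding _·_

    -- The generators are involutions, so either orientation of an edge is a right multiplication.
    label : ∀ (g h : V) → Adj g h → ∃[ q ] h Perm.≈ g · q
    label g h (s , s∈ , inj₁ eq) with q , s≈ ← generator s s∈ =
      q , λ i → trans (eq i) (cong (g ⟨$⟩ʳ_) (s≈ i))
    label g h (s , s∈ , inj₂ eq) with q , s≈ ← generator s s∈ =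
      q , λ i → sym (trans (cong (g ⟨$⟩ʳ_) (sym (s≈ i)))
        (trans (eq _) (cong (h ⟨$⟩ʳ_) (trans (cong (s ⟨$⟩ʳ_) (s≈ i)) (trans (s≈ _)
          (reversePrefix-involutive (suc (# q)) (s≤s (toℕ<n q)) i))))))

-- Only the words 1 2 1 and 2 1 2 satisfy the hypotheses. Antipodes in a hexagon are thus preserved
-- even where labels 1 and 2 might be interchanged.
alternating-triple : ∀ x y w → 1 ≤ x → 1 ≤ y → 1 ≤ w → x ≤ 2 → y ≤ 2 → w ≤ 2 →
                     x ≢ y → y ≢ w → ∀ z → ρ x (ρ y (ρ w z)) ≡ swap₁₂ z
alternating-triple 1 2 1 _ _ _ _ _ _ _ _ = λ _ → refl
alternating-triple 2 1 2 _ _ _ _ _ _ _ _ = braid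
alternating-triple 1 1 _ _ _ _ _ _ _ x≢y _ = contradiction refl x≢y
alternating-triple 2 2 _ _ _ _ _ _ _ x≢y _ = contradiction refl x≢y
alternating-triple _ 1 1 _ _ _ _ _ _ _ y≢w = contradiction refl y≢w
alternating-triple _ 2 2 _ _ _ _ _ _ _ y≢w = contradiction refl y≢w
alternating-triple (suc (suc (suc _))) _ _ _ _ _ (s≤s (s≤s ()))
alternating-triple _ (suc (suc (suc _))) _ _ _ _ _ (s≤s (s≤s ()))
alternating-triple _ _ (suc (suc (suc _))) _ _ _ _ _ (s≤s (s≤s ()))

-- The action of an automorphism on labels.

module _ {d : ℕ} (φ : SelfBijection (Group.setoid (Sym (suc d)))) where
  private
    V = Permutation′ (suc d)
    module S = Group (Sym (suc d))
    Φ : V → V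
    Φ = Inverse.to φ

  Φ-cong : ∀ {g h : V} → g Perm.≈ h → Φ g Perm.≈ Φ h
  Φ-cong {g} {h} = Inverse.to-cong φ {g} {h}

  Φ-injective : ∀ (g h : V) → Φ g Perm.≈ Φ h → g Perm.≈ h
  Φ-injective g h eq i =
    trans (sym (Inverse.strictlyInverseʳ φ g i)) (Inverse.inverseʳ φ {h} {Φ g} eq i)

  Keeps : Fin d → Set
  Keeps q = ∀ (g : V) → Φ (g · q) Perm.≈ Φ g · q

  module _ (keeps : ∀ q → Keeps q) where
    private
      prefix : Fin (suc d) → V
      prefix j = r₁ (suc (toℕ j)) (toℕ<n j)

    -- Including the trivial `prefix 0F` lets the factorisation below treat the positions `j` and
    -- `M` uniformly when they are 0.
    commutes-prefix : ∀ (g : V) j → Φ (g S.∙ prefix j) Perm.≈ Φ g S.∙ prefix j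
    commutes-prefix g (Fin.suc q) = keeps-suc
      where
      opaque
        unfolding _·_
        keeps-suc : Φ (g S.∙ prefix (Fin.suc q)) Perm.≈ Φ g S.∙ prefix (Fin.suc q)
        keeps-suc = keeps q g
    commutes-prefix g Fin.zero i  = trans
      (Φ-cong {g S.∙ prefix 0F} {g} (λ i → cong (g ⟨$⟩ʳ_) (trivial i)) i)
      (cong (Φ g ⟨$⟩ʳ_) (sym (trivial i)))
      where
      trivial : ∀ i → prefix 0F ⟨$⟩ʳ i ≡ i
      trivial Fin.zero    = refl
      trivial (Fin.suc _) = refl

    -- If s moves only the positions 0, …, m and s j ≡ m, reversing the prefixes ending at
    -- j and then at m brings m home; this writes s as a product of prefix reversals.
    commutes-supported : ∀ m → m ≤ suc d → ∀ (s : V) → (∀ i → m ≤ toℕ i → s ⟨$⟩ʳ i ≡ i) →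
                         ∀ g → Φ (g S.∙ s) Perm.≈ Φ g S.∙ s
    commutes-supported zero _ s fixed g i = trans
      (Φ-cong {g S.∙ s} {g} (λ i → cong (g ⟨$⟩ʳ_) (fixed i z≤n)) i)
      (cong (Φ g ⟨$⟩ʳ_) (sym (fixed i z≤n)))
    commutes-supported (suc m) m<n s fixed g i = begin
      Φ (g S.∙ s) ⟨$⟩ʳ i
        ≡⟨ Φ-cong {g S.∙ s} {g S.∙ t S.∙ prefix M S.∙ prefix j} (λ i → cong (g ⟨$⟩ʳ_) (s≈ i)) i ⟩
      Φ (g S.∙ t S.∙ prefix M S.∙ prefix j) ⟨$⟩ʳ i
        ≡⟨ commutes-prefix (g S.∙ t S.∙ prefix M) j i ⟩
      Φ (g S.∙ t S.∙ prefix M) ⟨$⟩ʳ (prefix j ⟨$⟩ʳ i)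
        ≡⟨ commutes-prefix (g S.∙ t) M _ ⟩
      Φ (g S.∙ t) ⟨$⟩ʳ (prefix M ⟨$⟩ʳ (prefix j ⟨$⟩ʳ i))
        ≡⟨ commutes-supported m (<⇒≤ m<n) t t-fixed g _ ⟩
      Φ g ⟨$⟩ʳ (t ⟨$⟩ʳ (prefix M ⟨$⟩ʳ (prefix j ⟨$⟩ʳ i)))
        ≡⟨ cong (Φ g ⟨$⟩ʳ_) (sym (s≈ i)) ⟩
      Φ g ⟨$⟩ʳ (s ⟨$⟩ʳ i)
        ∎
      where
      open ≡-Reasoning
      M j : Fin (suc d)
      M = fromℕ< m<n
      j = s ⟨$⟩ˡ M
      t : V
      t = s S.∙ prefix j S.∙ prefix M
      toℕ-M : toℕ M ≡ m
      toℕ-M = toℕ-fromℕ< m<n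
      prefix-involutive : ∀ k i → prefix k ⟨$⟩ʳ (prefix k ⟨$⟩ʳ i) ≡ i
      prefix-involutive k = reversePrefix-involutive (suc (toℕ k)) (toℕ<n k)
      s≈ : ∀ i → s ⟨$⟩ʳ i ≡ t ⟨$⟩ʳ (prefix M ⟨$⟩ʳ (prefix j ⟨$⟩ʳ i))
      s≈ i = cong (s ⟨$⟩ʳ_) (sym (trans
        (cong (prefix j ⟨$⟩ʳ_) (prefix-involutive M (prefix j ⟨$⟩ʳ i))) (prefix-involutive j i)))
      j≤m : toℕ j ≤ m
      j≤m with ≤-<-connex (toℕ j) m
      ... | inj₁ le = le
      ... | inj₂ m<j = ≤-reflexive (trans (cong toℕ (trans (sym (fixed j m<j)) (inverseʳ s))) toℕ-M)
      prefix-top : ∀ k → prefix k ⟨$⟩ʳ k ≡ 0F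
      prefix-top k = toℕ-injective (trans (toℕ-reversePrefix-ρ (toℕ k) (toℕ<n k) k) (ρ-top (toℕ k)))
      t-M : t ⟨$⟩ʳ M ≡ M
      t-M = begin
        s ⟨$⟩ʳ (prefix j ⟨$⟩ʳ (prefix M ⟨$⟩ʳ M))  ≡⟨ cong (λ k → s ⟨$⟩ʳ (prefix j ⟨$⟩ʳ k))
                                                           (trans (prefix-top M) (sym (prefix-top j))) ⟩
        s ⟨$⟩ʳ (prefix j ⟨$⟩ʳ (prefix j ⟨$⟩ʳ j))  ≡⟨ cong (s ⟨$⟩ʳ_) (prefix-involutive j j) ⟩
        s ⟨$⟩ʳ j                                  ≡⟨ inverseʳ s ⟩
        M                                         ∎
      prefix-fixes : ∀ k i → toℕ k < toℕ i → prefix k ⟨$⟩ʳ i ≡ i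
      prefix-fixes k i k<i = reversePrefix-fixes (suc (toℕ k)) (toℕ<n k) i (λ i<1+k → <⇒≱ k<i (s≤s⁻¹ i<1+k))
      t-fixed : ∀ i → m ≤ toℕ i → t ⟨$⟩ʳ i ≡ i
      t-fixed i m≤i with m≤n⇒m<n∨m≡n m≤i
      ... | inj₂ m≡i = subst (λ k → t ⟨$⟩ʳ k ≡ k) (toℕ-injective (trans toℕ-M m≡i)) t-M
      ... | inj₁ m<i = trans
        (cong (λ k → s ⟨$⟩ʳ (prefix j ⟨$⟩ʳ k)) (prefix-fixes M i (subst (_< toℕ i) (sym toℕ-M) m<i)))
        (trans (cong (s ⟨$⟩ʳ_) (prefix-fixes j i (≤-<-trans j≤m m<i))) (fixed i m<i))

    label-preserving⇒translation : LeftRegular (Sym (suc d)) φ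
    -- For `m = suc d` the support condition is vacuous, so `Φ` commutes with right multiplication
    -- by every permutation, here applied at the identity.
    label-preserving⇒translation = Φ S.ε , λ g i → trans
      (Φ-cong {g} {S.ε S.∙ g} (λ _ → refl) i)
      (commutes-supported (suc d) ≤-refl g (λ i d<i → contradiction (toℕ<n i) (≤⇒≯ d<i)) S.ε i)

  module _ (aut : Aut (Pancake (suc d)) φ) where
    opaque
      imageLabel : ∀ g q → ∃[ s ] Φ (g · q) Perm.≈ Φ g · s
      imageLabel g q = label (Φ g) (Φ (g · q)) (Equivalence.to (aut g (g · q)) (·-adjacent g q))

    -- A priori the image of a label depends on the vertex `g`.
    σ : V → Fin d → Fin d
    σ g q = proj₁ (imageLabel g q)

    σ-spec : ∀ g q → Φ (g · q) Perm.≈ Φ g · σ g q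
    σ-spec g q = proj₂ (imageLabel g q)

    σ-cong : ∀ (g h : V) q → g Perm.≈ h → σ g q ≡ σ h q
    σ-cong g h q g≈h = label-injective (Φ g) (σ g q) (σ h q) λ i →
      trans (sym (σ-spec g q i)) (trans (Φ-cong {g · q} {h · q} (·-cong g h q g≈h) i)
        (trans (σ-spec h q i) (sym (·-cong (Φ g) (Φ h) (σ h q) (Φ-cong {g} {h} g≈h) i))))

    σ-injective : ∀ (g : V) p q → σ g p ≡ σ g q → p ≡ q
    σ-injective g p q eq = label-injective g p q (Φ-injective (g · p) (g · q) λ i →
      trans (σ-spec g p i) (trans (cong (λ s → (Φ g · s) ⟨$⟩ʳ i) eq) (sym (σ-spec g q i))))

    -- Equal image labels would return to `Φ g` after two steps; by injectivity of `Φ` the original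
    -- walk would also return, forcing `p ≡ q`.
    σ-non-backtracking : ∀ (g : V) p q → p ≢ q → # (σ g p) ≢ # (σ (g · p) q)
    σ-non-backtracking g p q p≢q eq = p≢q (sym (label-injective (g · p) q p λ i →
      trans (Φ-injective (g · p · q) g back i) (sym (·-involutive g p i))))
      where
      back : Φ (g · p · q) Perm.≈ Φ g
      back i = trans (σ-spec (g · p) q i)
        (trans (·-cong (Φ (g · p)) (Φ g · σ g p) (σ (g · p) q) (σ-spec g p) i)
        (trans (cong (λ s → (Φ g · s · σ (g · p) q) ⟨$⟩ʳ i) (#-injective eq))
          (·-involutive (Φ g) (σ (g · p) q) i)))

    σ* : V → List (Fin d) → List (Fin d)
    σ* g []       = []
    σ* g (q ∷ ws) = σ g q ∷ σ* (g · q) ws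

    σ*-spec : ∀ g ws → Φ (g ·* ws) Perm.≈ Φ g ·* σ* g ws
    σ*-spec g []       i = refl
    σ*-spec g (q ∷ ws) i = trans (σ*-spec (g · q) ws i)
      (·*-cong (Φ (g · q)) (Φ g · σ g q) (σ* (g · q) ws) (σ-spec g q) i)

    hexagon-image : ∀ (g : V) a b → a ≢ b → (∀ z → evaluate (a ∷ b ∷ a ∷ b ∷ a ∷ b ∷ []) z ≡ z) →
      Hexagon (# (σ g a)) (# (σ (g · a) b)) (# (σ (g · a · b) a)) (# (σ (g · a · b · a) b))
              (# (σ (g · a · b · a · b) a)) (# (σ (g · a · b · a · b · a) b))
    hexagon-image g a b a≢b id = record
      { a>0 = z<s ; b>0 = z<s ; c>0 = z<s ; d>0 = z<s ; e>0 = z<s ; f>0 = z<s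
      ; a≢b = σ-non-backtracking g a b a≢b
      ; b≢c = σ-non-backtracking (g · a) b a (a≢b ∘ sym)
      ; c≢d = σ-non-backtracking (g · a · b) a b a≢b
      ; d≢e = σ-non-backtracking (g · a · b · a) b a (a≢b ∘ sym)
      ; e≢f = σ-non-backtracking (g · a · b · a · b) a b a≢b
      -- The walk returns to `g` only up to pointwise equality, so `σ-cong` is needed to compare its
      -- last label with its first.
      ; f≢a = λ eq → σ-non-backtracking (g · a · b · a · b · a) b a (a≢b ∘ sym)
                (trans eq (cong # (sym (σ-cong (g ·* ws) g a loop))))
      ; closed = ≈⇒evaluate (Φ g) (σ* g ws) [] λ i →
          trans (sym (σ*-spec g ws i)) (Φ-cong {g ·* ws} {g} loop i)
      }
      where
      ws : List (Fin d)
      ws = a ∷ b ∷ a ∷ b ∷ a ∷ b ∷ []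
      loop : g ·* ws Perm.≈ g
      loop = evaluate⇒≈ g ws [] id

    hexagon-bound : ∀ (g : V) a b → a ≢ b → (∀ z → evaluate (a ∷ b ∷ a ∷ b ∷ a ∷ b ∷ []) z ≡ z) →
      Bounded 2 (# (σ g a)) (# (σ (g · a) b)) (# (σ (g · a · b) a)) (# (σ (g · a · b · a) b))
              (# (σ (g · a · b · a · b) a)) (# (σ (g · a · b · a · b · a) b))
    hexagon-bound g a b a≢b id = hexagon-labels d (hexagon-image g a b a≢b id)
      (bounded (#≤ _) (#≤ _) (#≤ _) (#≤ _) (#≤ _) (#≤ _))
      where
      #≤ : ∀ (q : Fin d) → # q ≤ d + 2
      #≤ q = ≤-trans (toℕ<n q) (m≤m+n d 2)

-- Label preservation in degree at least 5.

module _ {e : ℕ} (φ : SelfBijection (Group.setoid (Sym (5 + e)))) (aut : Aut (Pancake (5 + e)) φ) where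
  private
    d = 4 + e
    V = Permutation′ (suc d)
    Φ : V → V
    Φ = Inverse.to φ
    s : V → Fin d → Fin d
    s = σ φ aut
    hexagon₁₂ : ∀ z → evaluate {d} (0F ∷ 1F ∷ 0F ∷ 1F ∷ 0F ∷ 1F ∷ []) z ≡ z
    hexagon₁₂ 0 = refl
    hexagon₁₂ 1 = refl
    hexagon₁₂ 2 = refl
    hexagon₁₂ (suc (suc (suc z))) = refl
    hexagon₂₁ : ∀ z → evaluate {d} (1F ∷ 0F ∷ 1F ∷ 0F ∷ 1F ∷ 0F ∷ []) z ≡ z
    hexagon₂₁ 0 = refl
    hexagon₂₁ 1 = refl
    hexagon₂₁ 2 = refl
    hexagon₂₁ (suc (suc (suc z))) = refl
    bound₁₂ = λ g → hexagon-bound φ aut g 0F 1F (λ ()) hexagon₁₂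

  σ₁≤2 : ∀ g → # (s g 0F) ≤ 2
  σ₁≤2 g = Bounded.a≤ (bound₁₂ g)

  σ₂≤2 : ∀ g → # (s g 1F) ≤ 2
  σ₂≤2 g = Bounded.a≤ (hexagon-bound φ aut g 1F 0F (λ ()) hexagon₂₁)

  -- Labels 1 and 2 are already taken by the images of `0F` and `1F`.
  3≤σ₃ : ∀ g → 3 ≤ # (s g 2F)
  3≤σ₃ g = separate _ _ _ (σ₁≤2 g) (σ₂≤2 g)
    (distinct 0F 1F λ ()) (distinct 0F 2F λ ()) (distinct 1F 2F λ ())
    where
    distinct : ∀ p q → p ≢ q → toℕ (s g p) ≢ toℕ (s g q)
    distinct p q p≢q eq = p≢q (σ-injective φ aut g p q (toℕ-injective eq))
    separate : ∀ x y z → suc x ≤ 2 → suc y ≤ 2 → x ≢ y → x ≢ z → y ≢ z → 3 ≤ suc z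
    separate 0 0 z _ _ x≢y _ _ = contradiction refl x≢y
    separate 1 1 z _ _ x≢y _ _ = contradiction refl x≢y
    separate 0 y 0 _ _ _ x≢z _ = contradiction refl x≢z
    separate 1 y 1 _ _ _ x≢z _ = contradiction refl x≢z
    separate x 0 0 _ _ _ _ y≢z = contradiction refl y≢z
    separate x 1 1 _ _ _ _ y≢z = contradiction refl y≢z
    separate (suc (suc _)) _ _ (s≤s (s≤s ()))
    separate _ (suc (suc _)) _ _ (s≤s (s≤s ()))
    separate _ _ (suc (suc z)) _ _ _ _ _ = s≤s (s≤s (s≤s z≤n))

  keeps-swap : ∀ g → Φ (g · 0F · 1F · 0F) Perm.≈ Φ g · 0F · 1F · 0F
  keeps-swap g i = trans (σ*-spec φ aut g X i) (evaluate⇒≈ (Φ g) (σ* φ aut g X) X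
    (alternating-triple _ _ _ z<s z<s z<s a≤ b≤ c≤
      (σ-non-backtracking φ aut g 0F 1F λ ()) (σ-non-backtracking φ aut (g · 0F) 1F 0F λ ())) i)
    where
    open Bounded (bound₁₂ g)
    X : List (Fin d)
    X = 0F ∷ 1F ∷ 0F ∷ []

  -- The middle is kept by `keeps-swap`, while the outer edges start at different vertices and may
  -- receive different labels.
  conjugate-image : ∀ g q → Φ (g · q · 0F · 1F · 0F · q) Perm.≈
                            Φ g · s g q · 0F · 1F · 0F · s (g · q · 0F · 1F · 0F) q
  conjugate-image g q i = trans (σ-spec φ aut (g · q · 0F · 1F · 0F) q i) (trans
    (·-cong (Φ (g · q · 0F · 1F · 0F)) (Φ (g · q) · 0F · 1F · 0F) l (keeps-swap (g · q)) i)
    (·*-cong (Φ (g · q)) (Φ g · s g q) (0F ∷ 1F ∷ 0F ∷ l ∷ []) (σ-spec φ aut g q) i))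
    where
    l : Fin d
    l = s (g · q · 0F · 1F · 0F) q

  keeps₃ : Keeps φ 2F
  keeps₃ g i = trans (σ-spec φ aut g 2F i) (cong (λ q → (Φ g · q) ⟨$⟩ʳ i) σ≡)
    where
    k l : Fin d
    k = s g 2F
    l = s (g · 2F · 0F · 1F · 0F) 2F
    X : List (Fin d)
    X = 0F ∷ 1F ∷ 0F ∷ []
    relation : g · 2F · 0F · 1F · 0F · 2F Perm.≈ g · 0F · 1F · 0F
    -- Reversing positions 0 to 3 exchanges 1 and 2, so it commutes with their transposition.
    relation = evaluate⇒≈ g (2F ∷ 0F ∷ 1F ∷ 0F ∷ 2F ∷ []) X λ z → trans (conjugate-swap 0 z) (braid z)
    σ≡ : k ≡ 2F
    σ≡ = #-injective (label-of-conjugate₃ {# k} {# l} (3≤σ₃ g)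
      (≈⇒evaluate (Φ g) (k ∷ 0F ∷ 1F ∷ 0F ∷ l ∷ []) X λ i → trans (sym (conjugate-image g 2F i))
        (trans (Φ-cong φ {g · 2F · 0F · 1F · 0F · 2F} {g · 0F · 1F · 0F} relation i) (keeps-swap g i))))

  -- Comparing the images of the two sides of `conjugate-swap` determines both the image of the next
  -- label and that of the edge labelled 1 in the middle of the right side.
  keeps-step : ∀ (i : Fin (1 + e)) → Keeps φ (Fin.suc (Fin.suc (inject₁ i))) →
    ∀ g → s g (Fin.suc (Fin.suc (Fin.suc i))) ≡ Fin.suc (Fin.suc (Fin.suc i))
        × s (g · Fin.suc (Fin.suc (inject₁ i))) 0F ≡ 0F
  keeps-step i keeps g = #-injective (proj₁ conclusion) , #-injective (proj₂ conclusion)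
    where
    q q′ k l t : Fin d
    q  = Fin.suc (Fin.suc (inject₁ i))
    q′ = Fin.suc (Fin.suc (Fin.suc i))
    k = s g q′
    l = s (g · q′ · 0F · 1F · 0F) q′
    t = s (g · q) 0F
    #q : # q ≡ 3 + toℕ i
    #q = cong (3 +_) (toℕ-inject₁ i)
    relation : g · q′ · 0F · 1F · 0F · q′ Perm.≈ g · q · 0F · q
    relation = evaluate⇒≈ g (q′ ∷ 0F ∷ 1F ∷ 0F ∷ q′ ∷ []) (q ∷ 0F ∷ q ∷ []) λ z →
      trans (conjugate-swap (1 + toℕ i) z) (cong (λ m → ρ m (ρ 1 (ρ m z))) (sym #q))
    rhs : Φ (g · q · 0F · q) Perm.≈ Φ g · q · t · q
    rhs i = trans (keeps (g · q · 0F) i) (trans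
      (·-cong (Φ (g · q · 0F)) (Φ (g · q) · t) q (σ-spec φ aut (g · q) 0F) i)
      (·*-cong (Φ (g · q)) (Φ g · q) (t ∷ q ∷ []) (keeps g) i))
    conclusion : # k ≡ 4 + toℕ i × # t ≡ 1
    conclusion = label-of-conjugate (toℕ i) {# k} {# l} {# t} z<s (σ₁≤2 (g · q)) λ z →
      trans (≈⇒evaluate (Φ g) (k ∷ 0F ∷ 1F ∷ 0F ∷ l ∷ []) (q ∷ t ∷ q ∷ []) (λ i →
          trans (sym (conjugate-image g q′ i)) (trans
            (Φ-cong φ {g · q′ · 0F · 1F · 0F · q′} {g · q · 0F · q} relation i) (rhs i))) z)
        (cong (λ m → ρ m (ρ (# t) (ρ m z))) #q)

  σ≡⇒keeps : ∀ q → (∀ g → s g q ≡ q) → Keeps φ q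
  σ≡⇒keeps q eq g i = trans (σ-spec φ aut g q i) (cong (λ p → (Φ g · p) ⟨$⟩ʳ i) (eq g))

  σ₁ : ∀ g → s g 0F ≡ 0F
  -- `keeps-step` speaks of vertices of the form `h · 2F`; take `h` to be `g · 2F`.
  σ₁ g = trans (σ-cong φ aut g (g · 2F · 2F) 0F (λ i → sym (·-involutive g 2F i)))
               (proj₂ (keeps-step 0F keeps₃ (g · 2F)))

  σ₂ : ∀ g → s g 1F ≡ 1F
  σ₂ g = second (s g 1F) (σ₂≤2 g) λ eq →
    contradiction (σ-injective φ aut g 1F 0F (trans eq (sym (σ₁ g)))) λ ()
    where
    second : ∀ (q : Fin d) → # q ≤ 2 → q ≢ 0F → q ≡ 1F
    second 0F _ q≢0 = contradiction refl q≢0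
    second 1F _ _   = refl
    second (Fin.suc (Fin.suc _)) (s≤s (s≤s ()))

  keeps-all : ∀ q → Keeps φ q
  keeps-all 0F = σ≡⇒keeps 0F σ₁
  keeps-all 1F = σ≡⇒keeps 1F σ₂
  keeps-all (Fin.suc (Fin.suc i)) = <-weakInduction (λ i → Keeps φ (Fin.suc (Fin.suc i))) keeps₃
    (λ i keeps → σ≡⇒keeps _ (λ g → proj₁ (keeps-step i keeps g))) i

-- Left translations as automorphisms, and the conclusion.

translation⇒automorphism : ∀ n φ → LeftRegular (Sym n) φ → Aut (Pancake n) φ
translation⇒automorphism n φ (y , φ≈) g h = mk⇔
  (λ where (s , s∈ , inj₁ eq) → s , s∈ , inj₁ (push g h s eq)
           (s , s∈ , inj₂ eq) → s , s∈ , inj₂ (push h g s eq))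
  (λ where (s , s∈ , inj₁ eq) → s , s∈ , inj₁ (pull g h s eq)
           (s , s∈ , inj₂ eq) → s , s∈ , inj₂ (pull h g s eq))
  where
  Φ = Inverse.to φ
  push : ∀ (g h s : Permutation′ n) → (∀ i → h ⟨$⟩ʳ i ≡ g ⟨$⟩ʳ (s ⟨$⟩ʳ i)) →
         ∀ i → Φ h ⟨$⟩ʳ i ≡ Φ g ⟨$⟩ʳ (s ⟨$⟩ʳ i)
  push g h s eq i = trans (φ≈ h i) (trans (cong (y ⟨$⟩ʳ_) (eq i)) (sym (φ≈ g _)))
  pull : ∀ (g h s : Permutation′ n) → (∀ i → Φ h ⟨$⟩ʳ i ≡ Φ g ⟨$⟩ʳ (s ⟨$⟩ʳ i)) →
         ∀ i → h ⟨$⟩ʳ i ≡ g ⟨$⟩ʳ (s ⟨$⟩ʳ i)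
  pull g h s eq i = trans (sym (inverseˡ y)) (trans
    (cong (y ⟨$⟩ˡ_) (trans (sym (φ≈ h i)) (trans (eq i) (φ≈ g _)))) (inverseˡ y))

theorem3p2 : ∀ (n : ℕ) → 5 ≤ n → Aut (Pancake n) ≐ LeftRegular (Sym n)
theorem3p2 _ (s≤s (s≤s (s≤s (s≤s (s≤s z≤n))))) =
  (λ {φ} aut → label-preserving⇒translation φ (keeps-all φ aut)) ,
  (λ {φ} → translation⇒automorphism _ φ)
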